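{- We have $C_{Q_7,\mathbf 1}=9$.
   Context: $\mathbb Z_7=\mathbb Z/7\mathbb Z$ and $Q_7=\{1,2,4\}$ is the set of non-zero squares in $\mathbb Z_7$. A sequence of length $k$ in $\mathbb Z_7$ is an element of $\mathbb Z_7^k$. A sequence $(x_1,\ldots,x_k)$ in $\mathbb Z_7$ is called a $(Q_7,\mathbf 1)$-weighted zero-sum sequence if there exist $a_1,\ldots,a_k\in Q_7$ such that $a_1x_1+\cdots+a_kx_k=0$ and $a_1+\cdots+a_k=0$ in $\mathbb Z_7$. The constant $C_{Q_7,\mathbf 1}$ is the least positive integer $k$ such that every sequence in $\mathbb Z_7$ of length $k$ has a (non-empty) $(Q_7,\mathbf 1)$-weighted zero-sum subsequence consisting of consecutive terms. -}

module Defs where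

open import Data.Fin.Base using (Fin; toℕ)
open import Data.Fin.Patterns using (0F)
open import Data.List.Relation.Binary.Infix.Heterogeneous using (Infix)
import Data.Nat.Base as ℕ
open ℕ using (ℕ; suc)
open import Data.Nat.DivMod using (_mod_)
open import Data.Product.Base using (_×_; ∃-syntax)
open import Data.Vec.Base using (Vec; foldr′; toList; zipWith)
open import Data.Vec.Relation.Unary.All using (All)
open import Relation.Binary.PropositionalEquality.Core using (_≡_; _≢_)

-- ℤ/7ℤ, by least non-negative residues.
ℤ₇ : Set
ℤ₇ = Fin 7

infixl 6 _+_
infixl 7 _*_

_+_ : ℤ₇ → ℤ₇ → ℤ₇
a + b = (toℕ a ℕ.+ toℕ b) mod 7

_*_ : ℤ₇ → ℤ₇ → ℤ₇
a * b = (toℕ a ℕ.* toℕ b) mod 7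

sum : ∀ {k} → Vec ℤ₇ k → ℤ₇
sum = foldr′ _+_ 0F

-- The set {1, 2, 4} of non-zero squares.
Q₇ : ℤ₇ → Set
Q₇ a = a ≢ 0F × ∃[ b ] a ≡ b * b

WeightedZeroSum : ∀ {k} → Vec ℤ₇ k → Set
WeightedZeroSum {k} xs =
  ∃[ as ] All Q₇ {k} as × sum (zipWith _*_ as xs) ≡ 0F × sum as ≡ 0F

-- Infix _≡_ says that the terms of ys occur consecutively in xs; the length
-- suc m makes ys non-empty.
HasConsecutiveWeightedZeroSum : ∀ {k} → Vec ℤ₇ k → Set
HasConsecutiveWeightedZeroSum xs =
  ∃[ m ] ∃[ ys ] Infix _≡_ (toList {n = suc m} ys) (toList xs) × WeightedZeroSum ys

record IsLeastPositive (P : ℕ → Set) (k : ℕ) : Set where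
  field
    positive : 0 ℕ.< k
    holds    : P k
    least    : ∀ m → 0 ℕ.< m → P m → k ℕ.≤ m

-- IsC k is the assertion that the constant C for the weights (Q₇, 1) equals k:
-- the constant is described by its defining property, which at most one k has.
IsC : ℕ → Set
IsC = IsLeastPositive λ k → (xs : Vec ℤ₇ k) → HasConsecutiveWeightedZeroSum xs

{-# OPTIONS --safe #-}

-- The pairs (Σ aᵢxᵢ, Σ aᵢ) attained on the non-empty prefixes of x ∷ xs are
-- determined by x and the set of those attained on the prefixes of xs.  This set
-- has at most 49 elements, so sequences can be enumerated by extending them to the
-- left, carrying only the set along and abandoning a branch as soon as (0, 0) is
-- attained: 3458 sequences survive, and none of them has length 9.  The sequence
-- 0,0,1,0,0,1,0,0 contains no zero-sum block, and hence neither do its prefixes.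
module Submission where

open import Defs

open import Data.Bool.Base using (Bool; true; false; T; _∨_)
open import Data.Bool.ListAction using (all; any)
open import Data.Bool.Properties using (T-∨; T-≡)
open import Data.Empty using (⊥)
open import Data.Fin.Patterns using (0F; 1F; 2F; 4F)
open import Data.Fin.Properties using (_≟_; all?; any?)
import Data.List.Base as List
open List using (List; []; _∷_; allFin)
open import Data.List.Membership.Propositional using (_∈_; find; lose)
open import Data.List.Membership.Propositional.Properties using (∈-allFin)
open import Data.List.Membership.DecPropositional (_≟_ {7}) using (_∈?_)
open import Data.List.Properties using (∷ʳ-++; ++-identityʳ)
open import Data.List.Relation.Binary.Infix.Heterogeneous using (Infix; here; there; _ⁱ++_)
open import Data.List.Relation.Binary.Prefix.Heterogeneous using (Prefix; []; _∷_)
import Data.List.Relation.Unary.All as ListAll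
import Data.List.Relation.Unary.All.Properties as ListAll
import Data.List.Relation.Unary.Any as Any
open Any using (Any)
open import Data.List.Relation.Unary.Any.Properties using (any⁻)
open import Data.Nat.Base using (ℕ; zero; suc; _≤_; z<s)
import Data.Nat.Base as ℕ
open import Data.Nat.Properties using (≮⇒≥; ≤-pred; m≤n⇒∃[o]m+o≡n)
open import Data.Product.Base using (_×_; _,_; ∃-syntax)
open import Data.Sum.Base as Sum using (_⊎_; inj₁; inj₂; [_,_]′)
open import Data.Vec.Base using (Vec; []; _∷_; initLast; lookup; tabulate; take; drop; toList; zipWith)
open import Data.Vec.Properties using (lookup∘tabulate; take++drop≡id; toList-++; toList-∷ʳ)
open import Data.Vec.Relation.Unary.All using (All; []; _∷_)
open import Function.Base using (_∘_)
open import Function.Bundles using (module Equivalence)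
open import Relation.Binary.PropositionalEquality using (_≡_; refl; sym; trans; cong; subst)
open import Relation.Nullary using (¬_; Dec; no)
open import Relation.Nullary.Decidable
  using (¬?; _×-dec_; _⊎-dec_; _→-dec_; from-yes; from-no; isYes; toWitness)
open import Relation.Unary using (Decidable)

open Equivalence using (to; from)

+-identityˡ : ∀ a → 0F + a ≡ a
+-identityˡ = from-yes (all? λ a → 0F + a ≟ a)

+-identityʳ : ∀ a → a + 0F ≡ a
+-identityʳ = from-yes (all? λ a → a + 0F ≟ a)

+-assoc : ∀ a b c → (a + b) + c ≡ a + (b + c)
+-assoc = from-yes (all? λ a → all? λ b → all? λ c → (a + b) + c ≟ a + (b + c))

Q₇? : Decidable Q₇
Q₇? a = ¬? (a ≟ 0F) ×-dec any? λ b → a ≟ b * b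

-- Enumerating the weights makes the choice of a coefficient a three-way `Any`, which can be decided
-- and computed.
weights : List ℤ₇
weights = 1F ∷ 2F ∷ 4F ∷ []

∈weights⇒Q₇ : ∀ {a} → a ∈ weights → Q₇ a
∈weights⇒Q₇ = ListAll.lookup (from-yes (ListAll.all? Q₇? weights))

Q₇⇒∈weights : ∀ {a} → Q₇ a → a ∈ weights
Q₇⇒∈weights {a} = from-yes (all? λ b → Q₇? b →-dec (b ∈? weights)) a

-- The offsets p and q stand for the sums already collected to the left.
record CompletesToZero {k} (p q : ℤ₇) (ys : Vec ℤ₇ k) : Set where
  constructor completion
  field
    coefficients : Vec ℤ₇ k
    inQ₇         : All Q₇ coefficients
    weightedSum  : p + sum (zipWith _*_ coefficients ys) ≡ 0F
    plainSum     : q + sum coefficients ≡ 0F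

-- Associativity moves the contribution of the first term into the offsets.
completes-∷⁺ : ∀ {k p q a x} {ys : Vec ℤ₇ k} → Q₇ a →
               CompletesToZero (p + a * x) (q + a) ys → CompletesToZero p q (x ∷ ys)
completes-∷⁺ {p = p} {q} {a} {x} qa (completion as qas p≡0 q≡0) =
  completion (a ∷ as) (qa ∷ qas)
    (trans (sym (+-assoc p (a * x) _)) p≡0)
    (trans (sym (+-assoc q a _)) q≡0)

completes-∷⁻ : ∀ {k p q x} {ys : Vec ℤ₇ k} → CompletesToZero p q (x ∷ ys) →
               ∃[ a ] Q₇ a × CompletesToZero (p + a * x) (q + a) ys
completes-∷⁻ {p = p} {q} {x} (completion (a ∷ as) (qa ∷ qas) p≡0 q≡0) =
  a , qa , completion as qas
    (trans (+-assoc p (a * x) _) p≡0)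
    (trans (+-assoc q a _) q≡0)

completes⇒zeroSum : ∀ {k} {ys : Vec ℤ₇ k} → CompletesToZero 0F 0F ys → WeightedZeroSum ys
completes⇒zeroSum {ys = ys} (completion as qas p≡0 q≡0) =
  as , qas ,
  trans (sym (+-identityˡ (sum (zipWith _*_ as ys)))) p≡0 ,
  trans (sym (+-identityˡ (sum as))) q≡0

zeroSum⇒completes : ∀ {k} {ys : Vec ℤ₇ k} → WeightedZeroSum ys → CompletesToZero 0F 0F ys
zeroSum⇒completes {ys = ys} (as , qas , p≡0 , q≡0) =
  completion as qas
    (trans (+-identityˡ (sum (zipWith _*_ as ys))) p≡0)
    (trans (+-identityˡ (sum as)) q≡0)

-- The coefficients are chosen one term at a time, so the answers for `x ∷ xs` depend only on `x`
-- and the answers for `xs` at shifted offsets. Splitting off the non-empty case keeps the empty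
-- prefix from counting as a block at offsets (0, 0).
ZeroPrefix NonEmptyZeroPrefix : ℤ₇ → ℤ₇ → List ℤ₇ → Set
ZeroPrefix p q xs = (p ≡ 0F × q ≡ 0F) ⊎ NonEmptyZeroPrefix p q xs
NonEmptyZeroPrefix p q []       = ⊥
NonEmptyZeroPrefix p q (x ∷ xs) = Any (λ a → ZeroPrefix (p + a * x) (q + a) xs) weights

ZeroBlock : List ℤ₇ → Set
ZeroBlock []       = ⊥
ZeroBlock (x ∷ xs) = NonEmptyZeroPrefix 0F 0F (x ∷ xs) ⊎ ZeroBlock xs

zeroPrefix? : ∀ p q xs → Dec (ZeroPrefix p q xs)
nonEmptyZeroPrefix? : ∀ p q xs → Dec (NonEmptyZeroPrefix p q xs)
zeroPrefix? p q xs = (p ≟ 0F ×-dec q ≟ 0F) ⊎-dec nonEmptyZeroPrefix? p q xs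
nonEmptyZeroPrefix? p q []       = no λ ()
nonEmptyZeroPrefix? p q (x ∷ xs) = Any.any? (λ a → zeroPrefix? (p + a * x) (q + a) xs) weights

zeroBlock? : Decidable ZeroBlock
zeroBlock? []       = no λ ()
zeroBlock? (x ∷ xs) = nonEmptyZeroPrefix? 0F 0F (x ∷ xs) ⊎-dec zeroBlock? xs

zeroPrefix-sound : ∀ {p q} xs → ZeroPrefix p q xs →
                   ∃[ m ] ∃[ ys ] Prefix _≡_ (toList {n = m} ys) xs × CompletesToZero p q ys
nonEmptyZeroPrefix-sound :
  ∀ {p q} xs → NonEmptyZeroPrefix p q xs →
  ∃[ m ] ∃[ ys ] Prefix _≡_ (toList {n = suc m} ys) xs × CompletesToZero p q ys
zeroPrefix-sound xs (inj₁ (refl , refl)) = 0 , [] , [] , completion [] [] refl refl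
zeroPrefix-sound xs (inj₂ z) with m , rest ← nonEmptyZeroPrefix-sound xs z = suc m , rest
nonEmptyZeroPrefix-sound (x ∷ xs) z
  with a , a∈ , z′ ← find z
  with m , ys , pre , c ← zeroPrefix-sound xs z′
  = m , x ∷ ys , refl ∷ pre , completes-∷⁺ (∈weights⇒Q₇ a∈) c

zeroPrefix-complete : ∀ {m p q} xs (ys : Vec ℤ₇ m) → Prefix _≡_ (toList ys) xs →
                      CompletesToZero p q ys → ZeroPrefix p q xs
nonEmptyZeroPrefix-complete :
  ∀ {m p q} xs (ys : Vec ℤ₇ (suc m)) → Prefix _≡_ (toList ys) xs →
  CompletesToZero p q ys → NonEmptyZeroPrefix p q xs
zeroPrefix-complete {p = p} {q} xs [] _ (completion [] [] p≡0 q≡0) =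
  inj₁ (trans (sym (+-identityʳ p)) p≡0 , trans (sym (+-identityʳ q)) q≡0)
zeroPrefix-complete xs (y ∷ ys) pre c = inj₂ (nonEmptyZeroPrefix-complete xs (y ∷ ys) pre c)
nonEmptyZeroPrefix-complete (x ∷ xs) (x ∷ ys) (refl ∷ pre) c
  with a , qa , c′ ← completes-∷⁻ c
  = lose (Q₇⇒∈weights qa) (zeroPrefix-complete xs ys pre c′)

-- At `toList xs` this unfolds to `HasConsecutiveWeightedZeroSum xs`; on lists the recursion carries
-- no length index.
ListHasZeroSum : List ℤ₇ → Set
ListHasZeroSum xs = ∃[ m ] ∃[ ys ] Infix _≡_ (toList {n = suc m} ys) xs × WeightedZeroSum ys

zeroBlock-sound : ∀ xs → ZeroBlock xs → ListHasZeroSum xs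
zeroBlock-sound (x ∷ xs) (inj₁ z) =
  let m , ys , pre , c = nonEmptyZeroPrefix-sound (x ∷ xs) z
  in m , ys , here pre , completes⇒zeroSum c
zeroBlock-sound (x ∷ xs) (inj₂ b) =
  let m , ys , inf , w = zeroBlock-sound xs b
  in m , ys , there inf , w

-- Used contrapositively for the lower bound: a negative decision of `ZeroBlock` rules out all
-- blocks and all weights at once.
zeroBlock-complete : ∀ xs → ListHasZeroSum xs → ZeroBlock xs
zeroBlock-complete (x ∷ xs) (m , ys , here pre , w) =
  inj₁ (nonEmptyZeroPrefix-complete (x ∷ xs) ys pre (zeroSum⇒completes {ys = ys} w))
zeroBlock-complete (x ∷ xs) (m , ys , there inf , w) =
  inj₂ (zeroBlock-complete xs (m , ys , inf , w))
zeroBlock-complete [] (m , _ ∷ _ , here () , w)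

zeroBlock-++ : ∀ ys {xs} → ZeroBlock xs → ZeroBlock (ys List.++ xs)
zeroBlock-++ []       b = b
zeroBlock-++ (y ∷ ys) b = inj₂ (zeroBlock-++ ys b)

-- Entry (p, q) of a table for xs tells whether ZeroPrefix p q xs holds.  Storing
-- the entries keeps the enumeration from recomputing them exponentially often.
Table : Set
Table = Vec (Vec Bool 7) 7

entry : Table → ℤ₇ → ℤ₇ → Bool
entry t p q = lookup (lookup t p) q

fromEntries : (ℤ₇ → ℤ₇ → Bool) → Table
fromEntries f = tabulate λ p → tabulate (f p)

entry-fromEntries : ∀ f p q → entry (fromEntries f) p q ≡ f p q
entry-fromEntries f p q
  rewrite lookup∘tabulate (λ p → tabulate (f p)) p = lookup∘tabulate (f p) q

vanish : ℤ₇ → ℤ₇ → Bool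
vanish p q = isYes (p ≟ 0F ×-dec q ≟ 0F)

nonEmptyEntry : Table → ℤ₇ → ℤ₇ → ℤ₇ → Bool
nonEmptyEntry t x p q = any (λ a → entry t (p + a * x) (q + a)) weights

emptyTable : Table
emptyTable = fromEntries vanish

extend : ℤ₇ → Table → Table
extend x t = fromEntries λ p q → vanish p q ∨ nonEmptyEntry t x p q

-- The search consults a table only to announce a block, so a true entry has to be backed by an
-- actual prefix.
Sound : Table → List ℤ₇ → Set
Sound t xs = ∀ p q → T (entry t p q) → ZeroPrefix p q xs

emptyTable-sound : Sound emptyTable []
emptyTable-sound p q h rewrite entry-fromEntries vanish p q = inj₁ (toWitness h)

nonEmptyEntry-sound : ∀ t {xs} → Sound t xs → ∀ x p q →
                      T (nonEmptyEntry t x p q) → NonEmptyZeroPrefix p q (x ∷ xs)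
nonEmptyEntry-sound t s x p q =
  Any.map (λ {a} → s (p + a * x) (q + a)) ∘ any⁻ (λ a → entry t (p + a * x) (q + a)) weights

extend-sound : ∀ t {xs} → Sound t xs → ∀ x → Sound (extend x t) (x ∷ xs)
extend-sound t s x p q h
  rewrite entry-fromEntries (λ p q → vanish p q ∨ nonEmptyEntry t x p q) p q
  = Sum.map toWitness (nonEmptyEntry-sound t s x p q) (to (T-∨ {vanish p q}) h)

-- Here `n` counts the terms still to be prepended. A block that appears on prepending `x` must
-- start at `x`, so only the entry at (0, 0) is tested. A branch reaching `zero` has met no block,
-- hence `false`.
unavoidable : ℕ → Table → Bool
unavoidable zero    t = false
unavoidable (suc n) t =
  all (λ x → nonEmptyEntry t x 0F 0F ∨ unavoidable n (extend x t)) (allFin 7)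

unavoidable-sound : ∀ n t {xs} → Sound t xs → unavoidable n t ≡ true →
                    ∀ (ys : Vec ℤ₇ n) → ZeroBlock (toList ys List.++ xs)
unavoidable-sound (suc n) t {xs} s h ys
  -- The sequence grows to the left, so the next term read is the last one of `ys`.
  with zs , z , refl ← initLast ys
  rewrite toList-∷ʳ z zs | ∷ʳ-++ (toList zs) z xs
  -- A block starting at `z` survives whatever stands to its left; otherwise the search goes on from
  -- `z ∷ xs`.
  = [ (λ now → zeroBlock-++ (toList zs) (inj₁ (nonEmptyEntry-sound t s z 0F 0F now)))
    , (λ later → unavoidable-sound n (extend z t) (extend-sound t s z) (to T-≡ later) zs)
    ]′ (to (T-∨ {nonEmptyEntry t z 0F 0F}) forced)
  where
  forced : T (nonEmptyEntry t z 0F 0F ∨ unavoidable n (extend z t))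
  forced = ListAll.lookup
    (ListAll.all⁺ (λ x → nonEmptyEntry t x 0F 0F ∨ unavoidable n (extend x t)) (allFin 7)
      (from T-≡ h))
    (∈-allFin z)

unavoidable-9 : unavoidable 9 emptyTable ≡ true
unavoidable-9 = refl

length-9-suffices : (xs : Vec ℤ₇ 9) → HasConsecutiveWeightedZeroSum xs
length-9-suffices xs =
  zeroBlock-sound (toList xs)
    (subst ZeroBlock (++-identityʳ (toList xs))
      (unavoidable-sound 9 emptyTable emptyTable-sound unavoidable-9 xs))

hasZeroSum-take : ∀ m {k} (xs : Vec ℤ₇ (m ℕ.+ k)) →
                  HasConsecutiveWeightedZeroSum (take m xs) → HasConsecutiveWeightedZeroSum xs
hasZeroSum-take m xs (l , ys , inf , w) =
  l , ys , subst (Infix _≡_ (toList ys)) eq (inf ⁱ++ toList (drop m xs)) , w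
  where
  eq : toList (take m xs) List.++ toList (drop m xs) ≡ toList xs
  eq = trans (sym (toList-++ (take m xs) (drop m xs))) (cong toList (take++drop≡id m xs))

-- With this, one sequence of length 8 without a block refutes every length below 9.
hasZeroSum-mono : ∀ {m n} → m ≤ n →
                  ((xs : Vec ℤ₇ m) → HasConsecutiveWeightedZeroSum xs) →
                  (xs : Vec ℤ₇ n) → HasConsecutiveWeightedZeroSum xs
hasZeroSum-mono {m} m≤n h xs with k , refl ← m≤n⇒∃[o]m+o≡n m≤n =
  hasZeroSum-take m xs (h (take m xs))

-- Since -1 is not a square mod 7, neither one weight nor two weights sum to 0. A block containing a
-- 1 contains at most two, so its weighted sum is non-zero; a block of zeros has at most two terms,
-- so its coefficients have non-zero sum.
zeroSumFree : Vec ℤ₇ 8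
zeroSumFree = 0F ∷ 0F ∷ 1F ∷ 0F ∷ 0F ∷ 1F ∷ 0F ∷ 0F ∷ []

zeroSumFree-correct : ¬ HasConsecutiveWeightedZeroSum zeroSumFree
zeroSumFree-correct h =
  from-no (zeroBlock? (toList zeroSumFree)) (zeroBlock-complete (toList zeroSumFree) h)

theorem3p11 : IsC 9
theorem3p11 = record
  { positive = z<s
  ; holds    = length-9-suffices
  ; least    = λ m _ h → ≮⇒≥ λ m<9 →
      zeroSumFree-correct (hasZeroSum-mono (≤-pred m<9) h zeroSumFree)
  }
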